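{- There exists an $n$-vertex graph that forces Algorithm Exh-S-kSSP (described in the context) to run for $\Omega(2^n)$ time to achieve a solution to the Single-Source Top-$k$ Simple Shortest Paths problem.
   Context: $G=(V,E,\omega)$ is a finite directed non-negatively weighted graph, $E\subseteq V\times V$, $\omega:E\to\mathbb{R}^+$ (undirected graphs are treated as having each edge in both directions, unweighted graphs as having all weights $1$); $N^+(v)=\{u\in V:(v,u)\in E\}$. A path from $s$ to $t$ is a vertex sequence $P=(s=v_1,\dots,v_\eta=t)$ with $(v_i,v_{i+1})\in E$ for all $i<\eta$; $V(P)$ is its vertex set; it is simple if it has no repeated vertex; its weight is $\omega(P)=\sum_{i=1}^{\eta-1}\omega(v_i,v_{i+1})$. For a path $\Pi$ ending at $v$ and an edge $(v,u)$, $\Pi\oplus(u)$ is $\Pi$ extended by $u$. The Single-Source Top-$k$ Simple Shortest Paths problem asks, given $G$, a root $r\in V$ and an integer $k>0$, for each $v\in V\setminus\{r\}$, for a set of pairwise distinct simple paths from $r$ to $v$ that consists of all simple $r$–$v$ paths if there are fewer than $k$ of them, and otherwise consists of exactly $k$ simple $r$–$v$ paths such that every simple $r$–$v$ path not in the set has weight at least that of every path in the set. Algorithm Exh-S-kSSP (input: $G$, $r$, $k$). Maintain a list $T_v$ for each $v\in V$ (initially empty) and a min-priority queue $PQ$ of paths keyed by weight, initially containing only the trivial path $(r)$ with key $0$. While $PQ\ne\emptyset$: remove from $PQ$ a path $\Pi=(r,\dots,v)$ of minimum weight; for each $u\in N^+(v)\setminus V(\Pi)$ insert $\Pi\oplus(u)$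 into $PQ$ with key $\omega(\Pi)+\omega(v,u)$; if $|T_v|<k$, add $\Pi$ to $T_v$. The same name is also used for the variant in which the loop additionally stops as soon as all vertices are saturated, where $v$ is saturated when $|T_v|=k$. The output is $(T_v)_{v\in V\setminus\{r\}}$. -}

module Defs where

open import Data.Bool using (Bool; T; T?; if_then_else_)
open import Data.Fin using (Fin; _≟_)
open import Data.List using (List; []; _∷_; [_]; _++_; allFin; length; mapMaybe)
open import Data.List.Membership.Propositional using (_∈_; _∉_)
open import Data.List.Relation.Binary.Permutation.Propositional using (_↭_)
open import Data.List.Relation.Unary.All using (All)
open import Data.List.Relation.Unary.Unique.Propositional using (Unique)
open import Data.Maybe using (Maybe; just; nothing)
open import Data.Nat using (ℕ; zero; suc; _<_; _<?_)
open import Data.Product using (∃; _×_; _,_)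
open import Data.Rational using (ℚ; 0ℚ; _+_; _≤_)
open import Data.Sum using (_⊎_)
open import Relation.Binary.PropositionalEquality using (_≡_; _≢_; refl)
open import Relation.Nullary using (¬_; does; yes; no)

-- Rational weights stand in for non-negative reals; the algorithm only adds and
-- compares them, so it treats such a graph as it would a real-weighted one.
record Graph (n : ℕ) : Set where
  field
    edge : Fin n → Fin n → Bool

  _⟶_ : Fin n → Fin n → Set
  u ⟶ v = T (edge u v)

  field
    ω        : ∀ {u v} → u ⟶ v → ℚ
    ω-nonNeg : ∀ {u v} (e : u ⟶ v) → 0ℚ ≤ ω e

module _ {n : ℕ} (G : Graph n) where
  open Graph G
  open import Data.List.Membership.DecPropositional (_≟_ {n}) using (_∈?_)

  infixl 5 _⊕_

  -- T b has at most one element, so two paths with the same endpoints are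
  -- equal exactly when their vertex sequences are.
  data Path (s : Fin n) : Fin n → Set where
    trivial : Path s s
    _⊕_     : ∀ {v u} → Path s v → v ⟶ u → Path s u

  -- Listed from the last vertex to the first.
  vertices : ∀ {s t} → Path s t → List (Fin n)
  vertices {s}     trivial = [ s ]
  vertices {t = t} (P ⊕ e) = t ∷ vertices P

  weight : ∀ {s t} → Path s t → ℚ
  weight trivial = 0ℚ
  weight (P ⊕ e) = weight P + ω e

  Simple : ∀ {s t} → Path s t → Set
  Simple P = Unique (vertices P)

  -- In the first alternative, L being a repetition-free list of all simple
  -- paths, length L is the number of simple paths.
  record IsTopK (k : ℕ) {s t : Fin n} (L : List (Path s t)) : Set where
    field
      simple   : All Simple L
      distinct : Unique L
      top      : (length L < k × (∀ P → Simple P → P ∈ L))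
               ⊎ (length L ≡ k ×
                  (∀ P → Simple P → P ∉ L → ∀ Q → Q ∈ L → weight Q ≤ weight P))

  IsSolution : (r : Fin n) (k : ℕ) → (∀ v → List (Path r v)) → Set
  IsSolution r k Ts = ∀ v → v ≢ r → IsTopK k (Ts v)

  module Exh-S-kSSP (r : Fin n) (k : ℕ) where

    record State : Set where
      constructor ⟨_,_⟩
      field
        PQ : List (∃ (Path r))
        Ts : ∀ v → List (Path r v)

    open State public

    initial : State
    initial = ⟨ [ r , trivial ] , (λ _ → []) ⟩

    extensions : ∀ {v} → Path r v → List (∃ (Path r))
    extensions {v} Π = mapMaybe extend (allFin n)
      where
      extend : Fin n → Maybe (∃ (Path r))
      extend u with T? (edge v u) | u ∈? vertices Π
      ... | yes e | no _  = just (u , Π ⊕ e)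
      ... | yes _ | yes _ = nothing
      ... | no _  | _     = nothing

    add : ∀ {v} → Path r v → (∀ w → List (Path r w)) → ∀ w → List (Path r w)
    add {v} Π Ts w with v ≟ w
    ... | yes refl = if does (length (Ts v) <? k) then Π ∷ Ts v else Ts v
    ... | no _     = Ts w

    -- One loop iteration. The queue is a multiset and ties between paths of
    -- minimum weight are broken arbitrarily.
    data _↝_ (σ : State) : State → Set where
      iterate : ∀ {v} (Π : Path r v) (rest : List (∃ (Path r))) →
                PQ σ ↭ (v , Π) ∷ rest →
                All (λ (_ , Q) → weight Π ≤ weight Q) rest →
                σ ↝ ⟨ extensions Π ++ rest , add Π (Ts σ) ⟩

    data Variant : Set where
      exhaustive saturating : Variant

    -- The root is exempt from saturation: the trivial path is the only simple
    -- path from r to r, so T_r could never be saturated for k ≥ 2, and for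
    -- k = 1 it is saturated after the first iteration.
    AllSaturated : State → Set
    AllSaturated σ = ∀ v → v ≢ r → length (Ts σ v) ≡ k

    Stops : Variant → State → Set
    Stops exhaustive σ = PQ σ ≡ []
    Stops saturating σ = PQ σ ≡ [] ⊎ AllSaturated σ

    -- Run x m σ : variant x can be in state σ after m loop iterations. As
    -- every iteration takes at least unit time, m is a lower bound for the
    -- running time.
    data Run (x : Variant) : ℕ → State → Set where
      start : Run x zero initial
      step  : ∀ {m σ τ} → Run x m σ → ¬ Stops x σ → σ ↝ τ → Run x (suc m) τ

{-# OPTIONS --safe #-}
-- Take the transitive tournament on 0 < 1 < … < N + 1 with arcs pointing downwards
-- and the top vertex as root; arcs into 0 have weight 1 and all others weight 0.
-- The 2^N paths from the root that avoid 0 have weight 0, while every path to 0 has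
-- weight 1, so all of the former leave the queue before the list of 0 becomes
-- non-empty.
module Submission where

open import Defs
open import Data.Bool using (true; false; T; T?; if_then_else_)
open import Data.Bool.Properties using (T-irrelevant)
open import Data.Fin using (Fin; zero; suc; toℕ; fromℕ; _≟_)
open import Data.Fin.Properties using (toℕ-fromℕ)
open import Data.List using (List; []; _∷_; _++_; allFin; length; map; mapMaybe; tabulate)
open import Data.List.Membership.Propositional using (_∈_; _∉_)
open import Data.List.Properties using (map-++; map-tabulate)
open import Data.List.Relation.Binary.Permutation.Propositional.Properties using (map⁺)
open import Data.List.Relation.Unary.All using (All; []; _∷_)
open import Data.List.Relation.Unary.AllPairs using ([]; _∷_)
open import Data.List.Relation.Unary.Any using (here; there)
open import Data.Maybe using (Maybe; just; nothing; maybe′)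
open import Data.Nat using (ℕ; zero; suc; _+_; _*_; _^_; _<ᵇ_; _≤_; _<_; _≥_; _>_; z≤n; s≤s)
open import Data.Nat.ListAction using (sum)
open import Data.Nat.ListAction.Properties using (sum-++; sum-↭)
open import Data.Nat.Properties hiding (_≟_)
open import Data.Product using (∃; ∃-syntax; _×_; _,_; proj₁; proj₂)
import Data.Rational as ℚ
import Data.Rational.Properties as ℚ
open import Data.Sum using (_⊎_; inj₁; inj₂)
open import Data.Unit using (tt)
open import Function using (_∘_; id)
open import Relation.Binary.PropositionalEquality
  using (_≡_; refl; sym; trans; cong; subst)
open import Relation.Nullary using (yes; no; contradiction)
open import Relation.Nullary.Decidable using (from-no)

sum-map-≤-mapMaybe : ∀ {A B : Set} (f : A → Maybe B) (w : B → ℕ) (g : A → ℕ) →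
  (∀ x → g x ≤ maybe′ w 0 (f x)) →
  ∀ xs → sum (map g xs) ≤ sum (map w (mapMaybe f xs))
sum-map-≤-mapMaybe f w g g≤ []       = z≤n
sum-map-≤-mapMaybe f w g g≤ (x ∷ xs) with f x | g≤ x
... | just _  | gx≤ = +-mono-≤ gx≤ (sum-map-≤-mapMaybe f w g g≤ xs)
... | nothing | gx≤ = +-mono-≤ gx≤ (sum-map-≤-mapMaybe f w g g≤ xs)

if-else-0-≤ : ∀ b {x y} → (T b → x ≤ y) → (if b then x else 0) ≤ y
if-else-0-≤ true  x≤y = x≤y tt
if-else-0-≤ false _   = z≤n

sum-below-≥ : (h : ℕ → ℕ) → (∀ i → h (suc i) ≤ h i + h i) → ∀ {n} (j : Fin n) →
  h (toℕ j) ≤ h 0 + sum (tabulate {n = n} λ i → if toℕ i <ᵇ toℕ j then h (toℕ i) else 0)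
sum-below-≥ h h≤ zero    = m≤m+n (h 0) _
sum-below-≥ h h≤ {suc n} (suc j) = begin
  h (suc (toℕ j))    ≤⟨ sum-below-≥ (h ∘ suc) (h≤ ∘ suc) j ⟩
  h 1 + s            ≤⟨ +-monoˡ-≤ s (h≤ 0) ⟩
  (h 0 + h 0) + s    ≡⟨ +-assoc (h 0) (h 0) s ⟩
  h 0 + (h 0 + s)    ∎
  where
  open ≤-Reasoning
  s = sum (tabulate {n = n} λ i → if toℕ i <ᵇ toℕ j then h (suc (toℕ i)) else 0)

module _ {n : ℕ} (G : Graph n) (r : Fin n) (k : ℕ) where
  open Graph G
  open Exh-S-kSSP G r k
  open import Data.List.Membership.DecPropositional (_≟_ {n}) using (_∈?_)

  -- The local function defining extensions has no name outside of Defs; it is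
  -- recovered by unification.
  extension-map : ∀ {v} (Π : Path G r v) →
    ∃[ f ] extensions Π ≡ mapMaybe f (allFin n)
  extension-map Π = _ , refl

  extension-map-just : ∀ {v} (Π : Path G r v) u (e : v ⟶ u) → u ∉ vertices G Π →
    proj₁ (extension-map Π) u ≡ just (u , Π ⊕ e)
  extension-map-just {v} Π u e u∉Π with T? (edge v u) | u ∈? vertices G Π
  ... | yes e′ | no _    = cong (λ e → just (u , Π ⊕ e)) (T-irrelevant e′ e)
  ... | yes _  | yes u∈Π = contradiction u∈Π u∉Π
  ... | no ¬e  | _       = contradiction e ¬e

module Hard (N : ℕ) where

  V : Set
  V = Fin (suc (suc N))

  arcWeight : V → ℚ.ℚ
  arcWeight zero    = ℚ.1ℚ
  arcWeight (suc _) = ℚ.0ℚ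

  arcWeight-nonNeg : ∀ v → ℚ.0ℚ ℚ.≤ arcWeight v
  arcWeight-nonNeg zero    = ℚ.nonNegative⁻¹ ℚ.1ℚ
  arcWeight-nonNeg (suc _) = ℚ.≤-refl

  G : Graph (suc (suc N))
  G = record
    { edge     = λ u v → toℕ v <ᵇ toℕ u
    ; ω        = λ {_} {v} _ → arcWeight v
    ; ω-nonNeg = λ {_} {v} _ → arcWeight-nonNeg v
    }

  open Graph G using (edge)

  r : V
  r = fromℕ (suc N)

  vertices-≥-end : ∀ {v w} (P : Path G r v) → w ∈ vertices G P → toℕ v ≤ toℕ w
  vertices-≥-end trivial (here refl) = ≤-refl
  vertices-≥-end (P ⊕ e) (here refl) = ≤-refl
  vertices-≥-end {v} (_⊕_ {u} P e) (there w∈P) =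
    ≤-trans (<⇒≤ (<ᵇ⇒< (toℕ v) (toℕ u) e)) (vertices-≥-end P w∈P)

  weight-suc : ∀ {i} (P : Path G r (suc i)) → weight G P ≡ ℚ.0ℚ
  weight-suc trivial             = refl
  weight-suc (_⊕_ {suc _} P e) = cong (ℚ._+ ℚ.0ℚ) (weight-suc P)

  weight-zero : (P : Path G r zero) → weight G P ≡ ℚ.1ℚ
  weight-zero (_⊕_ {suc _} P e) = cong (ℚ._+ ℚ.1ℚ) (weight-suc P)

  lightDescendants : V → ℕ
  lightDescendants zero    = 0
  lightDescendants (suc j) = 2 ^ toℕ j

  mass : ∃ (Path G r) → ℕ
  mass (v , _) = lightDescendants v

  totalMass : List (∃ (Path G r)) → ℕ
  totalMass = sum ∘ map mass

  totalMass-++ : ∀ Ps Qs → totalMass (Ps ++ Qs) ≡ totalMass Ps + totalMass Qs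
  totalMass-++ Ps Qs = trans (cong sum (map-++ mass Ps Qs)) (sum-++ (map mass Ps) (map mass Qs))

  totalMass-heavy : (Π : Path G r zero) → ∀ Ps →
    All (λ (_ , Q) → weight G Π ℚ.≤ weight G Q) Ps → totalMass Ps ≡ 0
  totalMass-heavy Π []                 []         = refl
  totalMass-heavy Π ((zero  , Q) ∷ Ps) (_ ∷ Π≤)   = totalMass-heavy Π Ps Π≤
  totalMass-heavy Π ((suc _ , Q) ∷ Ps) (Π≤Q ∷ _)
    rewrite weight-zero Π | weight-suc Q =
    contradiction Π≤Q (from-no (ℚ.1ℚ ℚ.≤? ℚ.0ℚ))

  module _ (k : ℕ) where
    open Exh-S-kSSP G r k

    totalMass-extensions : ∀ {j} (Π : Path G r (suc j)) →
      2 ^ toℕ j ≤ 1 + totalMass (extensions Π)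
    totalMass-extensions {j} Π = begin
      2 ^ toℕ j                                  ≤⟨ sum-below-≥ (2 ^_) double j ⟩
      1 + sum (tabulate (belowMass ∘ suc))       ≤⟨ s≤s (m≤n+m _ (belowMass zero)) ⟩
      1 + sum (tabulate belowMass)               ≡⟨ cong (suc ∘ sum) (map-tabulate id belowMass) ⟨
      1 + sum (map belowMass (allFin _))         ≤⟨ s≤s (sum-map-≤-mapMaybe (proj₁ (extension-map G r k Π)) mass belowMass belowMass≤ (allFin _)) ⟩
      1 + totalMass (extensions Π)               ∎
      where
      open ≤-Reasoning
      belowMass : V → ℕ
      belowMass u = if edge (suc j) u then lightDescendants u else 0
      double : ∀ i → 2 ^ suc i ≤ 2 ^ i + 2 ^ i
      double i = ≤-reflexive (cong (2 ^ i +_) (+-identityʳ (2 ^ i)))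
      belowMass≤ : ∀ u → belowMass u ≤ maybe′ mass 0 (proj₁ (extension-map G r k Π) u)
      belowMass≤ u = if-else-0-≤ (edge (suc j) u) λ e →
        ≤-reflexive (cong (maybe′ mass 0) (sym (extension-map-just G r k Π u e
          λ u∈Π → <⇒≱ (<ᵇ⇒< (toℕ u) (suc (toℕ j)) e) (vertices-≥-end Π u∈Π))))

    Invariant : ℕ → State → Set
    Invariant m σ = 2 ^ N ≤ m ⊎ (Ts σ zero ≡ [] × 2 ^ N ≤ m + totalMass (PQ σ))

    Invariant-↝ : ∀ {m σ τ} → Invariant m σ → σ ↝ τ → Invariant (suc m) τ
    Invariant-↝ (inj₁ N≤m) _ = inj₁ (m≤n⇒m≤1+n N≤m)
    Invariant-↝ {m} {σ} (inj₂ (_ , N≤)) (iterate {zero} Π rest PQ↭ Π≤) =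
      inj₁ (m≤n⇒m≤1+n (begin
        2 ^ N                    ≤⟨ N≤ ⟩
        m + totalMass (PQ σ)     ≡⟨ cong (m +_) (sum-↭ (map⁺ mass PQ↭)) ⟩
        m + totalMass rest       ≡⟨ cong (m +_) (totalMass-heavy Π rest Π≤) ⟩
        m + 0                    ≡⟨ +-identityʳ m ⟩
        m                        ∎))
      where open ≤-Reasoning
    Invariant-↝ {m} {σ} (inj₂ (T₀≡[] , N≤)) (iterate {suc j} Π rest PQ↭ _) =
      inj₂ (T₀≡[] , (begin
        2 ^ N                                                 ≤⟨ N≤ ⟩
        m + totalMass (PQ σ)                                  ≡⟨ cong (m +_) (sum-↭ (map⁺ mass PQ↭)) ⟩
        m + (2 ^ toℕ j + totalMass rest)                      ≤⟨ +-monoʳ-≤ m (+-monoˡ-≤ _ (totalMass-extensions Π)) ⟩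
        m + suc (totalMass (extensions Π) + totalMass rest)   ≡⟨ +-suc m _ ⟩
        suc m + (totalMass (extensions Π) + totalMass rest)   ≡⟨ cong (suc m +_) (totalMass-++ (extensions Π) rest) ⟨
        suc m + totalMass (extensions Π ++ rest)              ∎))
      where open ≤-Reasoning

    Invariant-Run : ∀ {x m σ} → Run x m σ → Invariant m σ
    Invariant-Run start = inj₂ (refl , ≤-reflexive
      (trans (cong (2 ^_) (sym (toℕ-fromℕ N))) (sym (+-identityʳ _))))
    Invariant-Run (step run _ σ↝τ) = Invariant-↝ (Invariant-Run run) σ↝τ

    PQ≡[]⇒2^N≤m : ∀ {x m σ} → Run x m σ → PQ σ ≡ [] → 2 ^ N ≤ m
    PQ≡[]⇒2^N≤m {m = m} run PQ≡[] with Invariant-Run run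
    ... | inj₁ N≤m      = N≤m
    ... | inj₂ (_ , N≤) =
      subst (2 ^ N ≤_) (trans (cong (λ PQ → m + totalMass PQ) PQ≡[]) (+-identityʳ m)) N≤

    T₀≢[]⇒2^N≤m : ∀ {x m σ} → Run x m σ → 0 < length (Ts σ zero) → 2 ^ N ≤ m
    T₀≢[]⇒2^N≤m run 0<T₀ with Invariant-Run run
    ... | inj₁ N≤m         = N≤m
    ... | inj₂ (T₀≡[] , _) = contradiction (subst (λ T₀ → 0 < length T₀) T₀≡[] 0<T₀) λ ()

    IsTopK⇒nonEmpty : k > 0 → ∀ {L : List (Path G r zero)} → IsTopK G k L → 0 < length L
    IsTopK⇒nonEmpty k>0 {_ ∷ _} _ = s≤s z≤n
    IsTopK⇒nonEmpty k>0 {[]} topK with IsTopK.top topK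
    ... | inj₁ (_ , complete) =
      contradiction (complete (trivial ⊕ tt) (((λ ()) ∷ []) ∷ [] ∷ [])) λ ()
    ... | inj₂ (refl , _)     = k>0

    2^N≤iterations : k > 0 → ∀ x {m σ} → Run x m σ →
      Stops x σ ⊎ IsSolution G r k (Ts σ) → 2 ^ N ≤ m
    2^N≤iterations k>0 x run (inj₂ solution) =
      T₀≢[]⇒2^N≤m run (IsTopK⇒nonEmpty k>0 (solution zero λ ()))
    2^N≤iterations k>0 exhaustive run (inj₁ PQ≡[]) = PQ≡[]⇒2^N≤m run PQ≡[]
    2^N≤iterations k>0 saturating run (inj₁ (inj₁ PQ≡[])) = PQ≡[]⇒2^N≤m run PQ≡[]
    2^N≤iterations k>0 saturating run (inj₁ (inj₂ saturated)) =
      T₀≢[]⇒2^N≤m run (subst (0 <_) (sym (saturated zero λ ())) k>0)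

theorem2 : ∃[ C ] ∃[ n₀ ] C > 0 × (∀ n → n ≥ n₀ →
    ∃[ G ] ∃[ r ] (∀ k → k > 0 →
    let open Exh-S-kSSP {n} G r k in
    ∀ (x : Variant) (m : ℕ) (σ : State) → Run x m σ →
    Stops x σ ⊎ IsSolution G r k (Ts σ) →
    2 ^ n ≤ C * m))
theorem2 = 4 , 2 , s≤s z≤n , λ where
  (suc (suc N)) _ → Hard.G N , Hard.r N , λ k k>0 x m σ run done →
    ≤-trans (≤-reflexive (sym (*-assoc 2 2 (2 ^ N))))
            (*-monoʳ-≤ 4 (Hard.2^N≤iterations N k k>0 x run done))
  (suc zero) (s≤s ())
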